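{- Fix a positive integer $k$ and a permutation $\rho$. Then $\lim_{n\to\infty}\left(\operatorname{op}_{n,k}(\rho)\right)^{1/n}$ exists and is a real number in $[1,\infty)$.
   Context: An ordered set partition of $[n]$ into $k$ blocks is a sequence $B_1/B_2/\cdots/B_k$ of nonempty, pairwise disjoint subsets of $[n]$ whose union is $[n]$; the order of the blocks matters, but not the order of elements within a block. For a permutation $\rho=\rho_1\cdots\rho_m\in\mathcal{S}_m$, an ordered partition $B_1/\cdots/B_k$ contains $\rho$ if there are block indices $i_1<i_2<\cdots<i_m$ and elements $b_j\in B_{i_j}$ such that $b_1\cdots b_m$ is order-isomorphic to $\rho$ (i.e. $b_a<b_c$ iff $\rho_a<\rho_c$); otherwise it avoids $\rho$. $\operatorname{op}_{n,k}(\rho)$ denotes the number of $\rho$-avoiding ordered partitions of $[n]$ into $k$ blocks.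
   Formalization: The permutation ρ is assumed to have length at least 2; for length at most 1 every ordered partition of [n] with n ≥ 1 contains ρ, so op_{n,k}(ρ) = 0 and the limit is 0, not in [1,∞). -}

module Defs where

open import Data.Bool using (true; false)
open import Data.Fin as Fin using (Fin)
import Data.Fin.Properties as Fin
open import Data.Fin.Permutation using (Permutation′; _⟨$⟩ʳ_)
open import Data.Fin.Subset using (Subset; _∈_; _∩_; Nonempty; Empty)
open import Data.Fin.Subset.Properties using (_∈?_; nonempty?)
open import Data.Integer as ℤ using (+_)
import Data.Integer.Properties as ℤ
open import Data.List using (List; []; _∷_; [_]; length; filter; cartesianProductWith; allFin)
import Data.List.Membership.Propositional as List
import Data.List.Membership.Propositional.Properties as List
open import Data.List.Relation.Unary.All using ([]; _∷_)
open import Data.List.Relation.Unary.AllPairs using ([]; _∷_)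
import Data.List.Relation.Unary.Any as Any
open import Data.List.Relation.Unary.Unique.Propositional using (Unique)
import Data.List.Relation.Unary.Unique.Propositional.Properties as Unique
open import Data.Nat as ℕ using (ℕ; zero; suc; NonZero)
import Data.Nat.Properties as ℕ
open import Data.Nat.Solver using (module +-*-Solver)
open import Data.Product using (∃; _×_; _,_)
open import Data.Rational as ℚ using (ℚ; 0ℚ; 1ℚ)
import Data.Rational.Properties as ℚ
import Data.Rational.Solver as ℚ
import Data.Rational.Unnormalised as ℚᵘ
import Data.Rational.Unnormalised.Properties as ℚᵘ
open import Data.Sum using (inj₁; inj₂)
open import Data.Vec using (Vec; []; _∷_; lookup)
import Data.Vec.Properties as Vec
open import Relation.Binary.PropositionalEquality using (_≡_; _≢_; refl; sym; trans; cong; cong₂; subst; subst₂)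
open import Relation.Nullary using (Dec; yes; no; ¬_; ¬?; _×-dec_; _→-dec_; map′)
open import Relation.Unary using (Decidable)

------------------------------------------------------------------------
-- Exhaustive duplicate-free enumeration of vectors

allVec : ∀ {A : Set} → List A → ∀ n → List (Vec A n)
allVec xs zero    = [ [] ]
allVec xs (suc n) = cartesianProductWith _∷_ xs (allVec xs n)

allVec-complete : ∀ {A : Set} {xs : List A} → (∀ x → x List.∈ xs) →
                  ∀ {n} (v : Vec A n) → v List.∈ allVec xs n
allVec-complete all []      = Any.here refl
allVec-complete all (x ∷ v) = List.∈-cartesianProductWith⁺ _∷_ (all x) (allVec-complete all v)

allVec-unique : ∀ {A : Set} {xs : List A} → Unique xs → ∀ n → Unique (allVec xs n)
allVec-unique u zero    = [] ∷ []
allVec-unique u (suc n) = Unique.cartesianProductWith⁺ _∷_ Vec.∷-injective u (allVec-unique u n)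

anyVec? : ∀ {k m} {P : Vec (Fin k) m → Set} → Decidable P → Dec (∃ P)
anyVec? {k} {m} P? = map′ Any.satisfied
  (λ (v , p) → List.lose (allVec-complete List.∈-allFin v) p)
  (Any.any? P? (allVec (allFin k) m))

allSubsets : ∀ n → List (Subset n)
allSubsets = allVec (true ∷ false ∷ [])

allSubsets-complete : ∀ {n} (p : Subset n) → p List.∈ allSubsets n
allSubsets-complete = allVec-complete λ where
  true  → Any.here refl
  false → Any.there (Any.here refl)

allSubsets-unique : ∀ n → Unique (allSubsets n)
allSubsets-unique = allVec-unique (((λ ()) ∷ []) ∷ [] ∷ [])

------------------------------------------------------------------------
-- Ordered set partitions and pattern avoidance
--
-- The ground set [n] is Fin n; B₁/⋯/B_k is the vector of its blocks.

record IsOrderedPartition {n k} (B : Vec (Subset n) k) : Set where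
  constructor isOrderedPartition
  field
    nonempty : ∀ i → Nonempty (lookup B i)
    disjoint : ∀ i j → i ≢ j → Empty (lookup B i ∩ lookup B j)
    covers   : ∀ x → ∃ λ i → x ∈ lookup B i

isOrderedPartition? : ∀ {n k} → Decidable (IsOrderedPartition {n} {k})
isOrderedPartition? B = map′
  (λ (ne , di , co) → isOrderedPartition ne di co)
  (λ (isOrderedPartition ne di co) → ne , di , co)
  (Fin.all? (λ i → nonempty? (lookup B i))
    ×-dec Fin.all? (λ i → Fin.all? λ j →
            ¬? (i Fin.≟ j) →-dec ¬? (nonempty? (lookup B i ∩ lookup B j)))
    ×-dec Fin.all? (λ x → Fin.any? λ i → x ∈? lookup B i))

-- In one-line notation ρ is (ρ ⟨$⟩ʳ 0) (ρ ⟨$⟩ʳ 1) ⋯ (ρ ⟨$⟩ʳ (m-1)).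

OrderIsomorphic : ∀ {m n} → Permutation′ m → Vec (Fin n) m → Set
OrderIsomorphic ρ b = ∀ a c →
    (lookup b a Fin.< lookup b c → ρ ⟨$⟩ʳ a Fin.< ρ ⟨$⟩ʳ c)
  × (ρ ⟨$⟩ʳ a Fin.< ρ ⟨$⟩ʳ c → lookup b a Fin.< lookup b c)

StrictlyIncreasing : ∀ {m k} → Vec (Fin k) m → Set
StrictlyIncreasing i = ∀ a c → a Fin.< c → lookup i a Fin.< lookup i c

Contains : ∀ {n k m} → Vec (Subset n) k → Permutation′ m → Set
Contains {n} {k} {m} B ρ =
  ∃ λ (i : Vec (Fin k) m) → StrictlyIncreasing i ×
  ∃ λ (b : Vec (Fin n) m) → (∀ j → lookup b j ∈ lookup B (lookup i j)) × OrderIsomorphic ρ b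

Avoids : ∀ {n k m} → Vec (Subset n) k → Permutation′ m → Set
Avoids B ρ = ¬ Contains B ρ

contains? : ∀ {n k m} (B : Vec (Subset n) k) (ρ : Permutation′ m) → Dec (Contains B ρ)
contains? B ρ =
  anyVec? λ i →
    Fin.all? (λ a → Fin.all? λ c → (a Fin.<? c) →-dec (lookup i a Fin.<? lookup i c))
    ×-dec anyVec? λ b →
      Fin.all? (λ j → lookup b j ∈? lookup B (lookup i j))
      ×-dec Fin.all? λ a → Fin.all? λ c →
        ((lookup b a Fin.<? lookup b c) →-dec (ρ ⟨$⟩ʳ a Fin.<? ρ ⟨$⟩ʳ c))
        ×-dec ((ρ ⟨$⟩ʳ a Fin.<? ρ ⟨$⟩ʳ c) →-dec (lookup b a Fin.<? lookup b c))

avoids? : ∀ {n k m} (B : Vec (Subset n) k) (ρ : Permutation′ m) → Dec (Avoids B ρ)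
avoids? B ρ = ¬? (contains? B ρ)

op : ∀ (n k : ℕ) {m} → Permutation′ m → ℕ
op n k ρ = length (filter (λ B → isOrderedPartition? B ×-dec avoids? B ρ)
                          (allVec (allSubsets n) k))

------------------------------------------------------------------------
-- Real numbers: Bishop's regular sequences of rationals

1/1+ : ℕ → ℚ
1/1+ n = + 1 ℚ./ suc n

record ℝ : Set where
  constructor mkℝ
  field
    seq     : ℕ → ℚ
    regular : ∀ i j → ℚ.∣ seq i ℚ.- seq j ∣ ℚ.≤ 1/1+ i ℚ.+ 1/1+ j

open ℝ public

infix 4 _≤_

_≤_ : ℝ → ℝ → Set
x ≤ y = ∀ n → seq x n ℚ.≤ seq y n ℚ.+ (1/1+ n ℚ.+ 1/1+ n)

private
  0≤1/1+ : ∀ n → 0ℚ ℚ.≤ 1/1+ n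
  0≤1/1+ n = ℚ.nonNegative⁻¹ (1/1+ n) {{ℚ.normalize-nonNeg 1 (suc n)}}

  0≤1/1++1/1+ : ∀ i j → 0ℚ ℚ.≤ 1/1+ i ℚ.+ 1/1+ j
  0≤1/1++1/1+ i j = ℚ.+-mono-≤ (0≤1/1+ i) (0≤1/1+ j)

  ∣p∣≤ : ∀ {p r} → p ℚ.≤ r → ℚ.- p ℚ.≤ r → ℚ.∣ p ∣ ℚ.≤ r
  ∣p∣≤ {p} p≤r -p≤r with ℚ.∣p∣≡p∨∣p∣≡-p p
  ... | inj₁ e = subst (ℚ._≤ _) (sym e) p≤r
  ... | inj₂ e = subst (ℚ._≤ _) (sym e) -p≤r

  p≤r+q⇒p-q≤r : ∀ {p q r} → p ℚ.≤ r ℚ.+ q → p ℚ.- q ℚ.≤ r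
  p≤r+q⇒p-q≤r {p} {q} {r} h =
    subst (p ℚ.- q ℚ.≤_) (solve 2 (λ r q → (r :+ q) :- q := r) refl r q)
          (ℚ.+-monoˡ-≤ (ℚ.- q) h)
    where open ℚ.+-*-Solver

  -[p-q] : ∀ p q → ℚ.- (p ℚ.- q) ≡ q ℚ.- p
  -[p-q] = solve 2 (λ p q → :- (p :- q) := q :- p) refl
    where open ℚ.+-*-Solver

  ∣p-q∣-comm : ∀ p q → ℚ.∣ p ℚ.- q ∣ ≡ ℚ.∣ q ℚ.- p ∣
  ∣p-q∣-comm p q = trans (sym (ℚ.∣-p∣≡∣p∣ (p ℚ.- q))) (cong ℚ.∣_∣ (-[p-q] p q))

  ∣p∣-∣q∣≤∣p-q∣ : ∀ p q → ℚ.∣ p ∣ ℚ.- ℚ.∣ q ∣ ℚ.≤ ℚ.∣ p ℚ.- q ∣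
  ∣p∣-∣q∣≤∣p-q∣ p q = p≤r+q⇒p-q≤r
    (subst (λ z → ℚ.∣ z ∣ ℚ.≤ ℚ.∣ p ℚ.- q ∣ ℚ.+ ℚ.∣ q ∣)
      (solve 2 (λ p q → (p :- q) :+ q := p) refl p q)
      (ℚ.∣p+q∣≤∣p∣+∣q∣ (p ℚ.- q) q))
    where open ℚ.+-*-Solver

  ∣∣p∣-∣q∣∣≤∣p-q∣ : ∀ p q → ℚ.∣ ℚ.∣ p ∣ ℚ.- ℚ.∣ q ∣ ∣ ℚ.≤ ℚ.∣ p ℚ.- q ∣
  ∣∣p∣-∣q∣∣≤∣p-q∣ p q = ∣p∣≤ (∣p∣-∣q∣≤∣p-q∣ p q)
    (subst₂ ℚ._≤_ (sym (-[p-q] ℚ.∣ p ∣ ℚ.∣ q ∣)) (∣p-q∣-comm q p) (∣p∣-∣q∣≤∣p-q∣ q p))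

  /-toℚᵘ : ∀ i n → ℚ.toℚᵘ (i ℚ./ suc n) ℚᵘ.≃ (i ℚᵘ./ suc n)
  /-toℚᵘ i n = ℚ.toℚᵘ-fromℚᵘ (ℚᵘ.mkℚᵘ i n)

-- The index of precision 1/(2(n+1)).
halve : ℕ → ℕ
halve n = suc (n ℕ.+ n)

private
  1/1+-halve : ∀ n → 1/1+ (halve n) ℚ.+ 1/1+ (halve n) ≡ 1/1+ n
  1/1+-halve n = ℚ.toℚᵘ-injective (begin
    ℚ.toℚᵘ (h ℚ.+ h)             ≈⟨ ℚ.toℚᵘ-homo-+ h h ⟩
    ℚ.toℚᵘ h ℚᵘ.+ ℚ.toℚᵘ h       ≈⟨ ℚᵘ.+-cong (/-toℚᵘ (+ 1) d) (/-toℚᵘ (+ 1) d) ⟩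
    ℚᵘ.mkℚᵘ (+ 1) d ℚᵘ.+ ℚᵘ.mkℚᵘ (+ 1) d ≈⟨ ℚᵘ.*≡* (cong +_ eq) ⟩
    ℚᵘ.mkℚᵘ (+ 1) n              ≈⟨ /-toℚᵘ (+ 1) n ⟨
    ℚ.toℚᵘ (1/1+ n)              ∎)
    where
    open import Relation.Binary.Reasoning.Setoid ℚᵘ.≃-setoid
    d = halve n
    h = 1/1+ d
    open +-*-Solver
    eq : (1 ℕ.* suc d ℕ.+ 1 ℕ.* suc d) ℕ.* suc n ≡ 1 ℕ.* (suc d ℕ.* suc d)
    eq = solve 1 (λ n → let e = con 2 :+ (n :+ n) in
           (con 1 :* e :+ con 1 :* e) :* (con 1 :+ n) := con 1 :* (e :* e)) refl n

fromℚ : ℚ → ℝ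
fromℚ q = mkℝ (λ _ → q) λ i j →
  subst (ℚ._≤ (1/1+ i ℚ.+ 1/1+ j)) (cong ℚ.∣_∣ (sym (ℚ.+-inverseʳ q))) (0≤1/1++1/1+ i j)

1ℝ : ℝ
1ℝ = fromℚ 1ℚ

infixl 6 _+_ _-_
infix 8 -_

_+_ : ℝ → ℝ → ℝ
x + y = mkℝ (λ n → seq x (halve n) ℚ.+ seq y (halve n)) λ i j →
  let x₁ = seq x (halve i); x₂ = seq x (halve j)
      y₁ = seq y (halve i); y₂ = seq y (halve j)
      e₁ = 1/1+ (halve i); e₂ = 1/1+ (halve j)
  in begin
    ℚ.∣ (x₁ ℚ.+ y₁) ℚ.- (x₂ ℚ.+ y₂) ∣
      ≡⟨ cong ℚ.∣_∣ (solve 4 (λ a b c d → (a :+ b) :- (c :+ d) := (a :- c) :+ (b :- d)) refl x₁ y₁ x₂ y₂) ⟩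
    ℚ.∣ (x₁ ℚ.- x₂) ℚ.+ (y₁ ℚ.- y₂) ∣
      ≤⟨ ℚ.∣p+q∣≤∣p∣+∣q∣ (x₁ ℚ.- x₂) (y₁ ℚ.- y₂) ⟩
    ℚ.∣ x₁ ℚ.- x₂ ∣ ℚ.+ ℚ.∣ y₁ ℚ.- y₂ ∣
      ≤⟨ ℚ.+-mono-≤ (regular x (halve i) (halve j)) (regular y (halve i) (halve j)) ⟩
    (e₁ ℚ.+ e₂) ℚ.+ (e₁ ℚ.+ e₂)
      ≡⟨ solve 2 (λ a b → (a :+ b) :+ (a :+ b) := (a :+ a) :+ (b :+ b)) refl e₁ e₂ ⟩
    (e₁ ℚ.+ e₁) ℚ.+ (e₂ ℚ.+ e₂)
      ≡⟨ cong₂ ℚ._+_ (1/1+-halve i) (1/1+-halve j) ⟩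
    1/1+ i ℚ.+ 1/1+ j ∎
  where
  open ℚ.≤-Reasoning
  open ℚ.+-*-Solver

-_ : ℝ → ℝ
- x = mkℝ (λ n → ℚ.- seq x n) λ i j →
  subst (ℚ._≤ (1/1+ i ℚ.+ 1/1+ j))
    (trans (∣p-q∣-comm (seq x i) (seq x j))
      (cong ℚ.∣_∣ (solve 2 (λ p q → q :- p := (:- p) :- (:- q)) refl (seq x i) (seq x j))))
    (regular x i j)
  where open ℚ.+-*-Solver

_-_ : ℝ → ℝ → ℝ
x - y = x + (- y)

∣_∣ : ℝ → ℝ
∣ x ∣ = mkℝ (λ n → ℚ.∣ seq x n ∣) λ i j →
  ℚ.≤-trans (∣∣p∣-∣q∣∣≤∣p-q∣ (seq x i) (seq x j)) (regular x i j)

------------------------------------------------------------------------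
-- n-th roots of natural numbers, n ≥ 1

-- For n ≥ 1, floorRoot n x = ⌊ x^(1/n) ⌋; see the two lemmas below.
floorRootUpTo : (n x bound : ℕ) → ℕ
floorRootUpTo n x zero    = zero
floorRootUpTo n x (suc b) with suc b ℕ.^ n ℕ.≤? x
... | yes _ = suc b
... | no  _ = floorRootUpTo n x b

floorRoot : (n x : ℕ) → ℕ
floorRoot n x = floorRootUpTo n x x

floorRoot-lower : ∀ n .{{_ : NonZero n}} x → floorRoot n x ℕ.^ n ℕ.≤ x
floorRoot-lower n@(suc _) x = go x
  where
  go : ∀ b → floorRootUpTo n x b ℕ.^ n ℕ.≤ x
  go zero = ℕ.z≤n
  go (suc b) with suc b ℕ.^ n ℕ.≤? x
  ... | yes p = p
  ... | no  _ = go b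

floorRoot-upper : ∀ n .{{_ : NonZero n}} x → x ℕ.< suc (floorRoot n x) ℕ.^ n
floorRoot-upper n@(suc n′) x = go x
    (ℕ.m≤m*n (suc x) (suc x ℕ.^ n′) {{ℕ.m^n≢0 (suc x) n′}})
  where
  go : ∀ b → x ℕ.< suc b ℕ.^ n → x ℕ.< suc (floorRootUpTo n x b) ℕ.^ n
  go zero h = h
  go (suc b) h with suc b ℕ.^ n ℕ.≤? x
  ... | yes _ = h
  ... | no ¬p = go b (ℕ.≰⇒> ¬p)

-- ⌊ (a d^n)^(1/n) ⌋ / d with d = j + 1: the largest multiple of 1/d that is
-- at most a^(1/n).
rootApprox : (n a j : ℕ) → ℚ
rootApprox n a j = + floorRoot n (a ℕ.* suc j ℕ.^ n) ℚ./ suc j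

private
  ^-distribʳ-* : ∀ n x y → (x ℕ.* y) ℕ.^ n ≡ x ℕ.^ n ℕ.* y ℕ.^ n
  ^-distribʳ-* zero    x y = refl
  ^-distribʳ-* (suc n) x y = trans (cong ((x ℕ.* y) ℕ.*_) (^-distribʳ-* n x y))
    (solve 4 (λ x y u v → (x :* y) :* (u :* v) := (x :* u) :* (y :* v)) refl x y (x ℕ.^ n) (y ℕ.^ n))
    where open +-*-Solver

  ^-cancelˡ-< : ∀ n {x y} → x ℕ.^ n ℕ.< y ℕ.^ n → x ℕ.< y
  ^-cancelˡ-< n {x} {y} h with x ℕ.<? y
  ... | yes p = p
  ... | no ¬p with () ← ℕ.<⇒≱ h (ℕ.^-monoˡ-≤ n (ℕ.≮⇒≥ ¬p))

  cross : ∀ n .{{_ : NonZero n}} a i j →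
    floorRoot n (a ℕ.* suc i ℕ.^ n) ℕ.* suc j ℕ.< suc (floorRoot n (a ℕ.* suc j ℕ.^ n)) ℕ.* suc i
  cross n a i j = ^-cancelˡ-< n (begin-strict
    (r ℕ.* suc j) ℕ.^ n                   ≡⟨ ^-distribʳ-* n r (suc j) ⟩
    r ℕ.^ n ℕ.* J                         ≤⟨ ℕ.*-monoˡ-≤ J (floorRoot-lower n (a ℕ.* I)) ⟩
    a ℕ.* I ℕ.* J                         ≡⟨ solve 3 (λ a i j → a :* i :* j := a :* j :* i) refl a I J ⟩
    a ℕ.* J ℕ.* I                         <⟨ ℕ.*-monoˡ-< I {{ℕ.m^n≢0 (suc i) n}} (floorRoot-upper n (a ℕ.* J)) ⟩
    suc s ℕ.^ n ℕ.* I                     ≡⟨ ^-distribʳ-* n (suc s) (suc i) ⟨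
    (suc s ℕ.* suc i) ℕ.^ n               ∎)
    where
    open ℕ.≤-Reasoning
    open +-*-Solver
    I = suc i ℕ.^ n
    J = suc j ℕ.^ n
    r = floorRoot n (a ℕ.* I)
    s = floorRoot n (a ℕ.* J)

  fraction-≤ : ∀ r s i j → r ℕ.* suc j ℕ.≤ suc s ℕ.* suc i →
               + r ℚ./ suc i ℚ.≤ 1/1+ j ℚ.+ (+ s ℚ./ suc j)
  fraction-≤ r s i j h = ℚ.toℚᵘ-cancel-≤ (begin
    ℚ.toℚᵘ (+ r ℚ./ suc i)                    ≃⟨ /-toℚᵘ (+ r) i ⟩
    ℚᵘ.mkℚᵘ (+ r) i                           ≤⟨ ℚᵘ.*≤* step ⟩
    ℚᵘ.mkℚᵘ (+ 1) j ℚᵘ.+ ℚᵘ.mkℚᵘ (+ s) j      ≃⟨ ℚᵘ.+-cong (/-toℚᵘ (+ 1) j) (/-toℚᵘ (+ s) j) ⟨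
    ℚ.toℚᵘ (1/1+ j) ℚᵘ.+ ℚ.toℚᵘ (+ s ℚ./ suc j) ≃⟨ ℚ.toℚᵘ-homo-+ (1/1+ j) (+ s ℚ./ suc j) ⟨
    ℚ.toℚᵘ (1/1+ j ℚ.+ (+ s ℚ./ suc j))       ∎)
    where
    open ℚᵘ.≤-Reasoning
    open +-*-Solver
    nat : r ℕ.* (suc j ℕ.* suc j) ℕ.≤ (1 ℕ.* suc j ℕ.+ s ℕ.* suc j) ℕ.* suc i
    nat = subst₂ ℕ._≤_ (ℕ.*-assoc r (suc j) (suc j))
      (solve 3 (λ s i j → (con 1 :+ s) :* i :* j := (con 1 :* j :+ s :* j) :* i) refl s (suc i) (suc j))
      (ℕ.*-monoˡ-≤ (suc j) h)
    step : + r ℤ.* + (suc j ℕ.* suc j) ℤ.≤ (+ 1 ℤ.* + suc j ℤ.+ + s ℤ.* + suc j) ℤ.* + suc i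
    step = subst₂ ℤ._≤_ (ℤ.pos-* r (suc j ℕ.* suc j))
      (trans (ℤ.pos-* (1 ℕ.* suc j ℕ.+ s ℕ.* suc j) (suc i))
             (cong (λ z → (+ (1 ℕ.* suc j) ℤ.+ z) ℤ.* + suc i) (ℤ.pos-* s (suc j))))
      (ℤ.+≤+ nat)

  rootApprox-≤ : ∀ n .{{_ : NonZero n}} a i j →
    rootApprox n a i ℚ.- rootApprox n a j ℚ.≤ 1/1+ j
  rootApprox-≤ n a i j = p≤r+q⇒p-q≤r (fraction-≤
    (floorRoot n (a ℕ.* suc i ℕ.^ n)) (floorRoot n (a ℕ.* suc j ℕ.^ n)) i j (ℕ.<⇒≤ (cross n a i j)))

root : (n : ℕ) .{{_ : NonZero n}} → ℕ → ℝ
root n a = mkℝ (rootApprox n a) λ i j → ∣p∣≤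
  (ℚ.≤-trans (rootApprox-≤ n a i j)
    (subst (ℚ._≤ (1/1+ i ℚ.+ 1/1+ j)) (ℚ.+-identityˡ (1/1+ j)) (ℚ.+-monoˡ-≤ (1/1+ j) (0≤1/1+ i))))
  (subst (ℚ._≤ (1/1+ i ℚ.+ 1/1+ j)) (sym (-[p-q] (rootApprox n a i) (rootApprox n a j)))
    (ℚ.≤-trans (rootApprox-≤ n a j i)
      (subst (ℚ._≤ (1/1+ i ℚ.+ 1/1+ j)) (ℚ.+-identityʳ (1/1+ i)) (ℚ.+-monoʳ-≤ (1/1+ i) (0≤1/1+ j)))))

------------------------------------------------------------------------
-- Limits of sequences x₁, x₂, …

ConvergesTo : ((n : ℕ) .{{_ : NonZero n}} → ℝ) → ℝ → Set
ConvergesTo x L = ∀ (ε : ℚ) → 0ℚ ℚ.< ε →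
  ∃ λ N → ∀ n .{{_ : NonZero n}} → N ℕ.≤ n → ∣ x n - L ∣ ≤ fromℚ ε

{-# OPTIONS --safe #-}
module Submission where

-- The limit is d = min(k, m - 1). An ordered partition is the word over k letters whose x-th letter
-- is the block of x, and avoiding ρ means that certain words with m distinct letters (one for each
-- choice of m letters) are not subwords.
--
-- Upper bound: read the word while tracking, for each forbidden word, the part not yet matched. A letter
-- that advances no match is called idle; since the next unmatched letter of the forbidden word on any m
-- letters is one of these letters, at most m - 1 letters are idle at a time. The other letters lower the
-- total unmatched length, so they are read boundedly often, and there are at most d^n (1 + k n)^R words.
--
-- Lower bound: if the first two letters of the pattern ascend, every word (k-1) ⋯ 1 0 v with the
-- letters of v below d avoids it; if they descend, the complements of these words do. Hence there are
-- at least d^(n - k) words.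

open import Defs hiding (_+_; _-_; -_; ∣_∣)
open import Data.Bool using (true; false)
open import Data.Empty using (⊥-elim)
open import Data.Fin as Fin using (Fin; zero; suc; toℕ; opposite)
import Data.Fin.Properties as Fin
open import Data.Fin.Permutation using (Permutation′; _⟨$⟩ʳ_; _⟨$⟩ˡ_; inverseˡ; inverseʳ)
open import Data.Fin.Subset using (Subset; _∈_)
open import Data.Fin.Subset.Properties using (x∈p∩q⁺; x∈p∩q⁻)
open import Data.Integer as ℤ using (+_; -[1+_])
import Data.Integer.Properties as ℤ
open import Data.List as List using (List; []; _∷_; length; allFin; concatMap; filter; cartesianProductWith)
open import Data.List.Properties using (length-map; length-++; length-filter; length-tabulate)
import Data.List.Membership.Propositional as Membership
import Data.List.Membership.Propositional.Properties as Membership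
open import Data.List.Relation.Binary.Sublist.Propositional as Sublist using (_∷ʳ_; _∷_)
open import Data.List.Relation.Unary.All as All using (All; []; _∷_)
import Data.List.Relation.Unary.All.Properties as All
open import Data.List.Relation.Unary.AllPairs using (AllPairs; []; _∷_)
import Data.List.Relation.Unary.AllPairs.Properties as AllPairs
open import Data.List.Relation.Unary.Any as Any using (Any; here; there)
import Data.List.Relation.Unary.Any.Properties as Any
open import Data.List.Relation.Unary.Unique.Propositional using (Unique)
import Data.List.Relation.Unary.Unique.Propositional.Properties as Unique
open import Data.Nat using (ℕ; zero; suc; _+_; _*_; _∸_; _^_; _⊓_; _⊔_; _<_; z≤n; s≤s; z<s; s<s; s≤s⁻¹; s<s⁻¹; NonZero; >-nonZero) renaming (_≤_ to _≤ℕ_)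
open import Data.Nat.ListAction using (sum)
open import Data.Nat.Properties
open import Data.Nat.Solver using (module +-*-Solver)
open import Data.Product using (∃; _×_; _,_; proj₁; proj₂)
open import Data.Rational as ℚ using (0ℚ; mkℚ)
import Data.Rational.Properties as ℚ
import Data.Rational.Solver as ℚ
import Data.Rational.Unnormalised as ℚᵘ
import Data.Rational.Unnormalised.Properties as ℚᵘ
open import Data.Sum using (_⊎_; inj₁; inj₂)
open import Data.Vec as Vec using (Vec; []; _∷_; lookup; tabulate; toList; _++_)
open import Data.Vec.Properties using (lookup∘tabulate; tabulate∘lookup; tabulate-cong; []=⇒lookup; lookup⇒[]=; lookup-map; lookup-++-<; lookup-++-≥; lookup-++ˡ; ++-injectiveʳ)
open import Function using (_∘_; id)
open import Relation.Binary using (tri<; tri≈; tri>)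
open import Relation.Binary.PropositionalEquality using (_≡_; refl; sym; trans; cong; cong₂; subst; subst₂; module ≡-Reasoning)
open import Relation.Nullary using (yes; no; does; ¬_; ¬?; _→-dec_; _×-dec_; contradiction)
open import Relation.Nullary.Decidable using (dec-true)
open import Relation.Unary using (Decidable)

-- Exponentials and polynomials

-- This is `1 + n / a ≤ (1 + 1 / a) ^ n` with denominators cleared.
bernoulli : ∀ a n → a ^ n * (a + n) ≤ℕ a * suc a ^ n
bernoulli a zero    = ≤-reflexive (solve 1 (λ a → con 1 :* (a :+ con 0) := a :* con 1) refl a)
  where open +-*-Solver
bernoulli a (suc n) = begin
  a ^ suc n * (a + suc n)             ≤⟨ m≤m+n _ (a ^ n * n) ⟩
  a ^ suc n * (a + suc n) + a ^ n * n ≡⟨ solve 3 (λ a p n → (a :* p) :* (a :+ (con 1 :+ n)) :+ p :* n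
                                                  := (con 1 :+ a) :* (p :* (a :+ n))) refl a (a ^ n) n ⟩
  suc a * (a ^ n * (a + n))           ≤⟨ *-monoʳ-≤ (suc a) (bernoulli a n) ⟩
  suc a * (a * suc a ^ n)             ≡⟨ solve 2 (λ a p → (con 1 :+ a) :* (a :* p) := a :* ((con 1 :+ a) :* p)) refl a (suc a ^ n) ⟩
  a * suc a ^ suc n                   ∎
  where
  open ≤-Reasoning
  open +-*-Solver

-- Two applications of Bernoulli's inequality give quadratic growth.
linear*exponential<exponential : ∀ a c n → a * suc a * c < n → a ^ n * (1 + c * n) < (2 + a) ^ n
-- For `a = 0` the factor `a * suc a` cannot be cancelled; but `n` is positive, so the left side is
-- `0`.
linear*exponential<exponential zero c (suc n) _ = m^n>0 2 (suc n)
linear*exponential<exponential a@(suc _) c n h = *-cancelˡ-< (a * suc a) _ _ (begin-strict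
  a * suc a * (a ^ n * (1 + c * n))
    ≡⟨ solve 4 (λ b p c n → b :* (p :* (con 1 :+ c :* n)) := p :* (b :+ (b :* c) :* n)) refl (a * suc a) (a ^ n) c n ⟩
  a ^ n * (a * suc a + a * suc a * c * n)
    <⟨ *-monoʳ-< (a ^ n) {{m^n≢0 a n}} step ⟩
  a ^ n * ((a + n) * (suc a + n))
    ≡⟨ *-assoc (a ^ n) (a + n) (suc a + n) ⟨
  a ^ n * (a + n) * (suc a + n)
    ≤⟨ *-monoˡ-≤ (suc a + n) (bernoulli a n) ⟩
  a * suc a ^ n * (suc a + n)
    ≡⟨ *-assoc a (suc a ^ n) (suc a + n) ⟩
  a * (suc a ^ n * (suc a + n))
    ≤⟨ *-monoʳ-≤ a (bernoulli (suc a) n) ⟩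
  a * (suc a * (2 + a) ^ n)
    ≡⟨ *-assoc a (suc a) ((2 + a) ^ n) ⟨
  a * suc a * (2 + a) ^ n ∎)
  where
  open ≤-Reasoning
  open +-*-Solver
  instance
    n≢0 : NonZero n
    n≢0 = >-nonZero (≤-<-trans z≤n h)
  step : a * suc a + a * suc a * c * n < (a + n) * (suc a + n)
  step = begin-strict
    a * suc a + a * suc a * c * n           <⟨ +-monoʳ-< (a * suc a) (*-monoˡ-< n h) ⟩
    a * suc a + n * n                       ≤⟨ m≤m+n _ (n * (a + suc a)) ⟩
    a * suc a + n * n + n * (a + suc a)     ≡⟨ solve 2 (λ a n → a :* (con 1 :+ a) :+ n :* n :+ n :* (a :+ (con 1 :+ a))
                                                          := (a :+ n) :* (con 1 :+ a :+ n)) refl a n ⟩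
    (a + n) * (suc a + n)                   ∎

^-distribʳ-* : ∀ x y n → (x * y) ^ n ≡ x ^ n * y ^ n
^-distribʳ-* x y zero    = refl
^-distribʳ-* x y (suc n) = trans (cong ((x * y) *_) (^-distribʳ-* x y n))
  (solve 4 (λ x y u v → (x :* y) :* (u :* v) := (x :* u) :* (y :* v)) refl x y (x ^ n) (y ^ n))
  where open +-*-Solver

-- After scaling by 3, the step from 3a to 3a + 1 absorbs r linear factors and the one from 3a + 1 to
-- 3a + 3 another one.
polynomial*exponential<exponential : ∀ r a c → ∃ λ N → ∀ n → N < n → a ^ n * (1 + c * n) ^ r < suc a ^ n
-- The inequality is strict only for positive `n`: at `n = 0` both sides are `1`.
polynomial*exponential<exponential zero a c = 0 , λ where
  n@(suc _) _ → subst (_< suc a ^ n) (sym (*-identityʳ (a ^ n))) (^-monoˡ-< n (n<1+n a))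
polynomial*exponential<exponential (suc r) a c =
  let N , bound = polynomial*exponential<exponential r (3 * a) c
      b = suc (3 * a)
  in N ⊔ b * suc b * c , λ n N<n → *-cancelˡ-< (3 ^ n) _ _ (begin-strict
    3 ^ n * (a ^ n * (1 + c * n) ^ suc r)
      ≡⟨ solve 4 (λ t p l q → t :* (p :* (l :* q)) := (t :* p) :* q :* l) refl (3 ^ n) (a ^ n) (1 + c * n) ((1 + c * n) ^ r) ⟩
    3 ^ n * a ^ n * (1 + c * n) ^ r * (1 + c * n)
      ≡⟨ cong (λ z → z * (1 + c * n) ^ r * (1 + c * n)) (^-distribʳ-* 3 a n) ⟨
    (3 * a) ^ n * (1 + c * n) ^ r * (1 + c * n)
      ≤⟨ *-monoˡ-≤ (1 + c * n) (<⇒≤ (bound n (m⊔n≤o⇒m≤o (suc N) (suc (b * suc b * c)) N<n))) ⟩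
    b ^ n * (1 + c * n)
      <⟨ linear*exponential<exponential b c n (m⊔n≤o⇒n≤o (suc N) (suc (b * suc b * c)) N<n) ⟩
    (2 + b) ^ n
      ≡⟨ cong (_^ n) (solve 1 (λ a → con 2 :+ (con 1 :+ con 3 :* a) := con 3 :* (con 1 :+ a)) refl a) ⟩
    (3 * suc a) ^ n
      ≡⟨ ^-distribʳ-* 3 (suc a) n ⟩
    3 ^ n * suc a ^ n ∎)
  where
  open ≤-Reasoning
  open +-*-Solver

-- Lists and vectors

lookup-ext : ∀ {A : Set} {n} {xs ys : Vec A n} → (∀ i → lookup xs i ≡ lookup ys i) → xs ≡ ys
lookup-ext {xs = xs} {ys} eq = trans (sym (tabulate∘lookup xs)) (trans (tabulate-cong eq) (tabulate∘lookup ys))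

AllPairs-lookup : ∀ {A : Set} {R : A → A → Set} {xs : List A} → AllPairs R xs →
                  ∀ {i j} → i Fin.< j → R (List.lookup xs i) (List.lookup xs j)
AllPairs-lookup (Rx ∷ _)  {zero}  {suc j} _   = All.lookup Rx (Membership.∈-lookup j)
AllPairs-lookup (_ ∷ Rxs) {suc i} {suc j} i<j = AllPairs-lookup Rxs (s<s⁻¹ i<j)

-- Pigeonhole: if `ys` were shorter, two entries of `xs` would sit at the same position of `ys` and
-- be equal.
Unique-⊆⇒length≤ : ∀ {A : Set} {xs ys : List A} → Unique xs → (∀ {x} → x Membership.∈ xs → x Membership.∈ ys) →
                   length xs ≤ℕ length ys
Unique-⊆⇒length≤ {xs = xs} {ys} unique sub = ≮⇒≥ λ ys<xs →
  let i , j , i<j , eq = Fin.pigeonhole ys<xs (Any.index ∘ position)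
  in AllPairs-lookup unique i<j
       (trans (Any.lookup-index (position i)) (trans (cong (List.lookup ys) eq) (sym (Any.lookup-index (position j)))))
  where
  position : ∀ i → List.lookup xs i Membership.∈ ys
  position i = sub (Membership.∈-lookup i)

-- Used to separate idle letters, with many continuations, from letters that advance a match. The
-- bound `t` is charged to every entry, so the second coefficient is simply `length xs`.
length-concatMap-≤ : ∀ {A B : Set} (f : A → List B) {P : A → Set} (P? : Decidable P) {s t} →
                     (∀ x → length (f x) ≤ℕ s) → (∀ x → P x → length (f x) ≤ℕ t) →
                     ∀ xs → length (concatMap f xs) ≤ℕ length (filter (¬? ∘ P?) xs) * s + length xs * t
length-concatMap-≤ f P? ≤s ≤t []       = z≤n
length-concatMap-≤ f P? {s} {t} ≤s ≤t (x ∷ xs)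
  rewrite length-++ (f x) {concatMap f xs} with P? x
... | yes px = begin
  length (f x) + length (concatMap f xs) ≤⟨ +-mono-≤ (≤t x px) (length-concatMap-≤ f P? ≤s ≤t xs) ⟩
  t + (r + length xs * t)                ≡⟨ solve 3 (λ t a b → t :+ (a :+ b) := a :+ (t :+ b)) refl t r (length xs * t) ⟩
  r + (t + length xs * t)                ∎
  where
  open ≤-Reasoning
  open +-*-Solver
  r = length (filter (¬? ∘ P?) xs) * s
... | no _ = begin
  length (f x) + length (concatMap f xs) ≤⟨ +-mono-≤ (≤s x) (length-concatMap-≤ f P? ≤s ≤t xs) ⟩
  s + (r + length xs * t)                ≤⟨ +-monoʳ-≤ s (+-monoʳ-≤ r (m≤n+m (length xs * t) t)) ⟩
  s + (r + (t + length xs * t))          ≡⟨ +-assoc s r _ ⟨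
  s + r + (t + length xs * t)            ∎
  where
  open ≤-Reasoning
  r = length (filter (¬? ∘ P?) xs) * s

-- Ordered partitions as words: letter x of the word is the block of x

blocks : ∀ {n k} → Vec (Fin k) n → Vec (Subset n) k
blocks w = tabulate λ i → tabulate λ x → does (lookup w x Fin.≟ i)

lookup-blocks : ∀ {n k} (w : Vec (Fin k) n) i x → lookup (lookup (blocks w) i) x ≡ does (lookup w x Fin.≟ i)
lookup-blocks w i x = trans
  (cong (λ p → lookup p x) (lookup∘tabulate (λ i → tabulate λ x → does (lookup w x Fin.≟ i)) i))
  (lookup∘tabulate (λ x → does (lookup w x Fin.≟ i)) x)

∈-blocks⁺ : ∀ {n k} (w : Vec (Fin k) n) {i x} → lookup w x ≡ i → x ∈ lookup (blocks w) i
∈-blocks⁺ w {i} {x} eq = lookup⇒[]= x _ (trans (lookup-blocks w i x) (dec-true (lookup w x Fin.≟ i) eq))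

∈-blocks⁻ : ∀ {n k} (w : Vec (Fin k) n) {i x} → x ∈ lookup (blocks w) i → lookup w x ≡ i
∈-blocks⁻ w {i} {x} x∈ with lookup w x Fin.≟ i | trans (sym (lookup-blocks w i x)) ([]=⇒lookup x∈)
... | yes eq | _ = eq
... | no _   | ()

blocks-injective : ∀ {n k} {v w : Vec (Fin k) n} → blocks v ≡ blocks w → v ≡ w
blocks-injective {v = v} {w} eq = lookup-ext λ x →
  sym (∈-blocks⁻ w (subst (λ B → x ∈ lookup B (lookup v x)) eq (∈-blocks⁺ v refl)))

blocks-isOrderedPartition : ∀ {n k} (w : Vec (Fin k) n) → (∀ i → ∃ λ x → lookup w x ≡ i) →
                            IsOrderedPartition (blocks w)
blocks-isOrderedPartition w onto = isOrderedPartition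
  (λ i → let x , eq = onto i in x , ∈-blocks⁺ w eq)
  (λ i j i≢j (x , x∈) → let x∈i , x∈j = x∈p∩q⁻ _ _ x∈ in
    i≢j (trans (sym (∈-blocks⁻ w x∈i)) (∈-blocks⁻ w x∈j)))
  (λ x → lookup w x , ∈-blocks⁺ w refl)

-- Covering supplies a block for each element, and disjointness rules out a second one.
blocks-surjective : ∀ {n k} {B : Vec (Subset n) k} → IsOrderedPartition B → ∃ λ w → B ≡ blocks w
blocks-surjective {B = B} (isOrderedPartition _ disjoint covers) =
  w , lookup-ext λ i → lookup-ext λ x → trans (entry i x) (sym (lookup-blocks w i x))
  where
  w = tabulate (proj₁ ∘ covers)
  x∈ : ∀ x → x ∈ lookup B (lookup w x)
  x∈ x = subst (λ i → x ∈ lookup B i) (sym (lookup∘tabulate (proj₁ ∘ covers) x)) (proj₂ (covers x))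
  entry : ∀ i x → lookup (lookup B i) x ≡ does (lookup w x Fin.≟ i)
  entry i x with lookup w x Fin.≟ i
  ... | yes refl = []=⇒lookup (x∈ x)
  ... | no ≢i with lookup (lookup B i) x in eq
  ...   | false = refl
  ...   | true  = ⊥-elim (disjoint (lookup w x) i ≢i (x , x∈p∩q⁺ (x∈ x , lookup⇒[]= x (lookup B i) eq)))

-- The automaton of forbidden subwords

-- An indexed family, so that matching on `starts` exposes the tail to `strip`.
data Starts {A : Set} (x : A) : List A → Set where
  starts : ∀ {u} → Starts x (x ∷ u)

starts? : ∀ {k} (x : Fin k) → Decidable (Starts x)
starts? x []      = no λ ()
starts? x (y ∷ u) with x Fin.≟ y
... | yes refl = yes starts
... | no x≢y   = no λ { starts → x≢y refl }

null? : ∀ {A : Set} → Decidable {A = List A} (_≡ [])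
null? []      = yes refl
null? (_ ∷ _) = no λ ()

module _ {k : ℕ} where

  Word : Set
  Word = List (Fin k)

  -- Greedy matching: `u` is the unmatched rest of a forbidden word, and its first letter is matched
  -- at the earliest opportunity.
  strip : Fin k → Word → Word
  strip x u with starts? x u
  ... | yes (starts {v}) = v
  ... | no _             = u

  advance : Fin k → List Word → List Word
  advance x = List.map (strip x)

  -- Contrapositively, if `x ∷ v` avoids `u`, then `v` avoids the rest that remains after reading
  -- `x`.
  strip-⊆ : ∀ x u {v} → strip x u Sublist.⊆ v → u Sublist.⊆ x ∷ v
  strip-⊆ x u s with starts? x u
  ... | yes starts = refl ∷ s
  ... | no _       = x ∷ʳ s

  All-strip : ∀ {P : Fin k → Set} x u → All P u → All P (strip x u)
  All-strip x u pu with starts? x u | pu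
  ... | yes starts | _ ∷ pv = pv
  ... | no _       | _      = pu

  length-strip-≤ : ∀ x u → length (strip x u) ≤ℕ length u
  length-strip-≤ x u with starts? x u
  ... | yes starts = n≤1+n _
  ... | no _       = ≤-refl

  length-strip-< : ∀ x u → Starts x u → length (strip x u) < length u
  length-strip-< x u s with starts? x u
  ... | yes starts = n<1+n _
  ... | no ¬s      = contradiction s ¬s

  potential : List Word → ℕ
  potential S = sum (List.map length S)

  potential-advance-≤ : ∀ x S → potential (advance x S) ≤ℕ potential S
  potential-advance-≤ x []      = z≤n
  potential-advance-≤ x (u ∷ S) = +-mono-≤ (length-strip-≤ x u) (potential-advance-≤ x S)

  potential-advance-< : ∀ x S → Any (Starts x) S → potential (advance x S) < potential S
  potential-advance-< x (u ∷ S) (here s)  = +-mono-<-≤ (length-strip-< x u s) (potential-advance-≤ x S)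
  potential-advance-< x (u ∷ S) (there h) = +-mono-≤-< (length-strip-≤ x u) (potential-advance-< x S h)

  -- A rest `[]` in the state is a completed forbidden word. The final state is not tested, so the
  -- list may exceed the avoiding words; an upper bound only requires that none is missing.
  avoiders : List Word → ∀ n → List (Vec (Fin k) n)
  avoiders S zero    = [] ∷ []
  avoiders S (suc n) with Any.any? null? S
  ... | yes _ = []
  ... | no _  = concatMap (λ x → List.map (x ∷_) (avoiders (advance x S) n)) (allFin k)

  avoiders-complete : ∀ {n} (w : Vec (Fin k) n) S → All (λ u → ¬ u Sublist.⊆ toList w) S → w Membership.∈ avoiders S n
  avoiders-complete []      S _      = here refl
  avoiders-complete (x ∷ w) S avoids with Any.any? null? S
  ... | yes null = let ¬s , eq = All.lookupAny avoids null in
    ⊥-elim (¬s (subst (Sublist._⊆ _) (sym eq) (Sublist.minimum _)))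
  ... | no _     = Membership.∈-concatMap⁺ _ (Any.map (λ { refl → Membership.∈-map⁺ (x ∷_) w∈ }) (Membership.∈-allFin x))
    where
    w∈ = avoiders-complete w (advance x S) (All.map⁺ (All.map (λ {u} ¬s s → ¬s (strip-⊆ x u s)) avoids))

  -- Counting the words that the automaton admits

  module _ {m₁ : ℕ} where

    -- The strictly increasing vectors i are the sets of m = suc m₁ letters.
    Covering : List Word → Set
    Covering S = ∀ (i : Vec (Fin k) (suc m₁)) → StrictlyIncreasing i → Any (All λ x → ∃ λ t → lookup i t ≡ x) S

    -- Stripping only removes letters, so a rest whose letters lie in a given set keeps that
    -- property.
    advance-covering : ∀ x {S} → Covering S → Covering (advance x S)
    advance-covering x cov i inc = Any.map⁺ (Any.map (λ {u} → All-strip x u) (cov i inc))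

    idle : List Word → List (Fin k)
    idle S = filter (λ x → ¬? (Any.any? (starts? x) S)) (allFin k)

    -- Among `suc m₁` idle letters, the rest over this set is nonempty, and its first letter would
    -- be an idle letter that advances a match.
    length-idle≤m₁ : ∀ S → Covering S → ¬ Any (_≡ []) S → length (idle S) ≤ℕ m₁
    length-idle≤m₁ S cov ¬null = s≤s⁻¹ (≰⇒> impossible)
      where
      impossible : ¬ suc m₁ ≤ℕ length (idle S)
      impossible m≤ = refute (cov i inc)
        where
        -- The first `suc m₁` idle letters; they increase since `filter` keeps the order of
        -- `allFin k`.
        letter : Fin (suc m₁) → Fin k
        letter t = List.lookup (idle S) (Fin.inject≤ t m≤)
        i = tabulate letter
        sorted : AllPairs Fin._<_ (idle S)
        sorted = AllPairs.filter⁺ _ (AllPairs.tabulate⁺-< λ i<j → i<j)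
        inc : StrictlyIncreasing i
        inc a c a<c = subst₂ Fin._<_ (sym (lookup∘tabulate letter a)) (sym (lookup∘tabulate letter c))
          (AllPairs-lookup sorted (subst₂ _<_ (sym (Fin.toℕ-inject≤ a m≤)) (sym (Fin.toℕ-inject≤ c m≤)) a<c))
        refute : ¬ Any (All λ x → ∃ λ t → lookup i t ≡ x) S
        refute a with Membership.find a
        ... | [] , []∈S , _ = ¬null (Any.map sym []∈S)
        ... | (x ∷ u) , xu∈S , (t , eq) ∷ _ =
          proj₂ (Membership.∈-filter⁻ (λ x → ¬? (Any.any? (starts? x) S)) {xs = allFin k}
                  (subst (Membership._∈ idle S) (trans (sym (lookup∘tabulate letter t)) eq) (Membership.∈-lookup (Fin.inject≤ t m≤))))
                (Any.map (λ { refl → starts }) xu∈S)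

    -- With `d = k ⊓ m₁`, the count satisfies `a (n + 1) P ≤ d * a n P + k * a n (P -
    -- 1)`: at most `d` idle letters keep the budget `P`, and the others, at most `k`, spend a unit
    -- of it. The claimed bound is stable under this recursion.
    length-avoiders : .{{_ : NonZero (k ⊓ m₁)}} → ∀ n P S → Covering S → potential S ≤ℕ P →
                      length (avoiders S n) ≤ℕ (k ⊓ m₁) ^ n * (1 + k * n) ^ P
    length-avoiders zero    P S cov _ = ≤-trans (m^n>0 (1 + k * 0) P) (≤-reflexive (sym (*-identityˡ _)))
    length-avoiders (suc n) P S cov S≤P with Any.any? null? S
    ... | yes _ = z≤n
    ... | no ¬null = begin
      length (concatMap f (allFin k))
        ≤⟨ length-concatMap-≤ f (λ x → Any.any? (starts? x) S) {d ^ n * b ^ P} {busy P}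
             (λ x → len x P (≤-trans (potential-advance-≤ x S) S≤P)) (≤busy P S≤P) (allFin k) ⟩
      length (idle S) * (d ^ n * b ^ P) + length (allFin k) * busy P
        ≤⟨ +-mono-≤ (*-monoˡ-≤ (d ^ n * b ^ P) (⊓-glb idle≤k (length-idle≤m₁ S cov ¬null)))
                    (≤-reflexive (cong (_* busy P) length-allFin)) ⟩
      d * (d ^ n * b ^ P) + k * busy P
        ≤⟨ total P ⟩
      d ^ suc n * (b + k) ^ P
        ≡⟨ cong (λ z → d ^ suc n * z ^ P) (solve 2 (λ k n → con 1 :+ k :* n :+ k := con 1 :+ k :* (con 1 :+ n)) refl k n) ⟩
      d ^ suc n * (1 + k * suc n) ^ P ∎
      where
      open ≤-Reasoning
      open +-*-Solver
      d = k ⊓ m₁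
      b = 1 + k * n
      f : Fin k → List (Vec (Fin k) (suc n))
      f x = List.map (x ∷_) (avoiders (advance x S) n)
      -- Bounds the continuations after a letter that advances a match; with budget `0` no such
      -- letter exists, hence the value `0`.
      busy : ℕ → ℕ
      busy zero    = 0
      busy (suc Q) = d ^ n * b ^ Q
      length-allFin : length (allFin k) ≡ k
      length-allFin = length-tabulate _
      idle≤k : length (idle S) ≤ℕ k
      idle≤k = ≤-trans (length-filter _ (allFin k)) (≤-reflexive length-allFin)
      len : ∀ x Q → potential (advance x S) ≤ℕ Q → length (f x) ≤ℕ d ^ n * b ^ Q
      len x Q h = ≤-trans (≤-reflexive (length-map (x ∷_) (avoiders (advance x S) n)))
                          (length-avoiders n Q (advance x S) (advance-covering x cov) h)
      ≤busy : ∀ Q → potential S ≤ℕ Q → ∀ x → Any (Starts x) S → length (f x) ≤ℕ busy Q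
      ≤busy zero    h x s = contradiction (≤-trans (potential-advance-< x S s) h) λ ()
      ≤busy (suc Q) h x s = len x Q (s≤s⁻¹ (≤-trans (potential-advance-< x S s) h))
      total : ∀ Q → d * (d ^ n * b ^ Q) + k * busy Q ≤ℕ d ^ suc n * (b + k) ^ Q
      total zero    = ≤-reflexive (solve 3 (λ d e k → d :* (e :* con 1) :+ k :* con 0 := d :* e :* con 1) refl d (d ^ n) k)
      total (suc Q) = begin
        d * (d ^ n * (b * b ^ Q)) + k * (d ^ n * b ^ Q)
          -- Since `d ≥ 1`, `k ≤ d * k`, and both summands share the factor `d`.
          ≤⟨ +-monoʳ-≤ (d * (d ^ n * (b * b ^ Q))) (*-monoˡ-≤ (d ^ n * b ^ Q) (m≤n*m k d)) ⟩
        d * (d ^ n * (b * b ^ Q)) + d * k * (d ^ n * b ^ Q)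
          ≡⟨ solve 5 (λ d e b c k → d :* (e :* (b :* c)) :+ d :* k :* (e :* c) := d :* e :* ((b :+ k) :* c))
                     refl d (d ^ n) b (b ^ Q) k ⟩
        d ^ suc n * ((b + k) * b ^ Q)
          ≤⟨ *-monoʳ-≤ (d ^ suc n) (*-monoʳ-≤ (b + k) (^-monoˡ-≤ Q (m≤m+n b k))) ⟩
        d ^ suc n * ((b + k) * (b + k) ^ Q) ∎

-- Occurrences of the pattern and the upper bound

-- Turns a sublist derivation into positions: a skipped letter shifts all of them, a matched one
-- puts `zero` in front.
embedding : ∀ {A : Set} {m n} (g : Fin m → A) (w : Vec A n) → List.tabulate g Sublist.⊆ toList w →
            ∃ λ (f : Fin m → Fin n) → (∀ {s t} → s Fin.< t → f s Fin.< f t) × (∀ t → lookup w (f t) ≡ g t)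
embedding {m = zero}  g w       _         = (λ ()) , (λ { {()} }) , λ ()
embedding {m = suc m} g (x ∷ w) (.x ∷ʳ s) =
  let f , mono , eq = embedding g w s in suc ∘ f , s<s ∘ mono , eq
embedding {m = suc m} g (x ∷ w) (refl ∷ s) =
  let f , mono , eq = embedding (g ∘ suc) w s in
  (λ { zero → zero ; (suc t) → suc (f t) }) ,
  (λ { {zero} {suc t} _ → z<s ; {suc s} {suc t} s<t → s<s (mono (s<s⁻¹ s<t)) }) ,
  (λ { zero → refl ; (suc t) → eq t })

mono⇒cancel-< : ∀ {m n} {f : Fin m → Fin n} → (∀ {s t} → s Fin.< t → f s Fin.< f t) →
                ∀ {s t} → f s Fin.< f t → s Fin.< t
mono⇒cancel-< mono {s} {t} fs<ft with Fin.<-cmp s t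
... | tri< s<t _ _  = s<t
... | tri≈ _ refl _ = ⊥-elim (Fin.<-irrefl refl fs<ft)
... | tri> _ _ t<s  = ⊥-elim (Fin.<-asym fs<ft (mono t<s))

-- An occurrence of `ρ` in the blocks `i`, read by increasing elements: the element of rank `t`
-- comes from the block with index `ρ ⟨$⟩ˡ t`.
subword : ∀ {k m} → Permutation′ m → Vec (Fin k) m → List (Fin k)
subword ρ i = List.tabulate λ t → lookup i (ρ ⟨$⟩ˡ t)

subword⇒contains : ∀ {n k m} (ρ : Permutation′ m) (i : Vec (Fin k) m) (w : Vec (Fin k) n) → StrictlyIncreasing i →
                   subword ρ i Sublist.⊆ toList w → Contains (blocks w) ρ
subword⇒contains ρ i w inc s =
  let f , mono , eq = embedding _ w s
      -- The element for index `a` is the position of the subword's letter number `ρ ⟨$⟩ʳ a`; as `f`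
      -- increases, these elements are ordered like `ρ`.
      b = tabulate (f ∘ (ρ ⟨$⟩ʳ_))
      lookup-b = lookup∘tabulate (f ∘ (ρ ⟨$⟩ʳ_))
  in i , inc , b ,
     (λ j → ∈-blocks⁺ w (trans (cong (lookup w) (lookup-b j)) (trans (eq (ρ ⟨$⟩ʳ j)) (cong (lookup i) (inverseˡ ρ))))) ,
     λ a c → (λ lt → mono⇒cancel-< mono (subst₂ Fin._<_ (lookup-b a) (lookup-b c) lt)) ,
             (λ lt → subst₂ Fin._<_ (sym (lookup-b a)) (sym (lookup-b c)) (mono lt))

strictlyIncreasing? : ∀ {m k} → Decidable (StrictlyIncreasing {m} {k})
strictlyIncreasing? i = Fin.all? λ a → Fin.all? λ c → (a Fin.<? c) →-dec (lookup i a Fin.<? lookup i c)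

forbidden : ∀ k {m} → Permutation′ m → List (List (Fin k))
forbidden k {m} ρ = List.map (subword ρ) (filter strictlyIncreasing? (allVec (allFin k) m))

op-upper : ∀ k m₁ .{{_ : NonZero (k ⊓ m₁)}} (ρ : Permutation′ (suc m₁)) n →
           op n k ρ ≤ℕ (k ⊓ m₁) ^ n * (1 + k * n) ^ potential (forbidden k ρ)
op-upper k m₁ ρ n = begin
  op n k ρ                                    ≤⟨ Unique-⊆⇒length≤ (Unique.filter⁺ good? (allVec-unique (allSubsets-unique n) k)) covered ⟩
  length (List.map blocks (avoiders (forbidden k ρ) n)) ≡⟨ length-map blocks (avoiders (forbidden k ρ) n) ⟩
  length (avoiders (forbidden k ρ) n)         ≤⟨ length-avoiders n _ (forbidden k ρ) covering ≤-refl ⟩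
  (k ⊓ m₁) ^ n * (1 + k * n) ^ potential (forbidden k ρ) ∎
  where
  open ≤-Reasoning
  good? = λ (B : Vec (Subset n) k) → isOrderedPartition? B ×-dec avoids? B ρ
  -- Before any letter is read, the forbidden word made from `i` is itself a rest over the letters
  -- of `i`.
  covering : Covering (forbidden k ρ)
  covering i inc = Any.map⁺ (Any.map (λ { refl → All.tabulate⁺ λ t → ρ ⟨$⟩ˡ t , refl })
    (Membership.∈-filter⁺ strictlyIncreasing? (allVec-complete Membership.∈-allFin i) inc))
  covered : ∀ {B} → B Membership.∈ filter good? (allVec (allSubsets n) k) → B Membership.∈ List.map blocks (avoiders (forbidden k ρ) n)
  covered B∈ with Membership.∈-filter⁻ good? {xs = allVec (allSubsets n) k} B∈
  ... | _ , part , avoids with blocks-surjective part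
  ...   | w , refl = Membership.∈-map⁺ blocks (avoiders-complete w (forbidden k ρ) (All.map⁺ (All.tabulate λ {i} i∈ s →
          avoids (subword⇒contains ρ i w (proj₂ (Membership.∈-filter⁻ strictlyIncreasing? {xs = allVec (allFin k) _} i∈)) s))))

-- Descending words

opposite-cancel-< : ∀ {n} {x y : Fin n} → opposite y Fin.< opposite x → x Fin.< y
opposite-cancel-< {n} {x} {y} lt = s≤s⁻¹ (≰⇒> λ y≤x → <⇒≱ lt
  (subst₂ _≤ℕ_ (sym (Fin.opposite-prop x)) (sym (Fin.opposite-prop y)) (∸-monoʳ-≤ n y≤x)))

strictlyIncreasing-injective : ∀ {m k} (i : Vec (Fin k) m) → StrictlyIncreasing i →
                               ∀ {a c} → lookup i a ≡ lookup i c → a ≡ c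
strictlyIncreasing-injective i inc {a} {c} eq with Fin.<-cmp a c
... | tri< a<c _ _ = ⊥-elim (Fin.<-irrefl eq (inc a c a<c))
... | tri≈ _ a≡c _ = a≡c
... | tri> _ _ c<a = ⊥-elim (Fin.<-irrefl (sym eq) (inc c a c<a))

⟨$⟩ˡ-injective : ∀ {m} (ρ : Permutation′ m) {s t} → ρ ⟨$⟩ˡ s ≡ ρ ⟨$⟩ˡ t → s ≡ t
⟨$⟩ˡ-injective ρ eq = trans (sym (inverseʳ ρ)) (trans (cong (ρ ⟨$⟩ʳ_) eq) (inverseʳ ρ))

Vec-map-injective : ∀ {A B : Set} {f : A → B} → (∀ {x y} → f x ≡ f y → x ≡ y) →
                    ∀ {n} {v w : Vec A n} → Vec.map f v ≡ Vec.map f w → v ≡ w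
Vec-map-injective {f = f} inj {v = v} {w} eq = lookup-ext λ i →
  inj (trans (sym (lookup-map i f v)) (trans (cong (λ u → lookup u i) eq) (lookup-map i f w)))

length-allVec : ∀ {A : Set} (xs : List A) n → length (allVec xs n) ≡ length xs ^ n
length-allVec xs zero    = refl
length-allVec xs (suc n) = trans (length-product xs) (cong (length xs *_) (length-allVec xs n))
  where
  length-product : ∀ ys → length (cartesianProductWith _∷_ ys (allVec xs n)) ≡ length ys * length (allVec xs n)
  length-product []       = refl
  length-product (y ∷ ys) = trans (length-++ (List.map (y ∷_) (allVec xs n)))
    (cong₂ _+_ (length-map (y ∷_) (allVec xs n)) (length-product ys))

-- Positions that ascend or repeat a letter can only carry letters below `d`.
Descending : ∀ {k n} → ℕ → Vec (Fin k) n → Set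
Descending d w = ∀ {x y} → x Fin.< y → lookup w y Fin.< lookup w x ⊎ (toℕ (lookup w x) < d × toℕ (lookup w y) < d)

-- The descending prefix uses every letter, which keeps all blocks nonempty; `v` is the free part
-- that is counted.
canonical : ∀ {k d r} → d ≤ℕ k → Vec (Fin d) r → Vec (Fin k) (k + r)
canonical d≤k v = tabulate opposite ++ Vec.map (λ x → Fin.inject≤ x d≤k) v

lookup-canonical-< : ∀ {k d r} (d≤k : d ≤ℕ k) (v : Vec (Fin d) r) x → toℕ x < k →
                     toℕ (lookup (canonical d≤k v) x) ≡ k ∸ suc (toℕ x)
lookup-canonical-< {k} d≤k v x x<k = begin
  toℕ (lookup (canonical d≤k v) x)                  ≡⟨ cong toℕ (lookup-++-< (tabulate opposite) _ x x<k) ⟩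
  toℕ (lookup (tabulate opposite) (Fin.fromℕ< x<k)) ≡⟨ cong toℕ (lookup∘tabulate opposite (Fin.fromℕ< x<k)) ⟩
  toℕ (opposite (Fin.fromℕ< x<k))                   ≡⟨ Fin.opposite-prop (Fin.fromℕ< x<k) ⟩
  k ∸ suc (toℕ (Fin.fromℕ< x<k))                    ≡⟨ cong (λ z → k ∸ suc z) (Fin.toℕ-fromℕ< x<k) ⟩
  k ∸ suc (toℕ x)                                   ∎
  where open ≡-Reasoning

lookup-canonical-≥ : ∀ {k d r} (d≤k : d ≤ℕ k) (v : Vec (Fin d) r) x → k ≤ℕ toℕ x →
                     toℕ (lookup (canonical d≤k v) x) < d
lookup-canonical-≥ {d = d} d≤k v x k≤x = begin-strict
  toℕ (lookup (canonical d≤k v) x)                           ≡⟨ cong toℕ (lookup-++-≥ (tabulate opposite) _ x k≤x) ⟩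
  toℕ (lookup (Vec.map (λ y → Fin.inject≤ y d≤k) v) j)       ≡⟨ cong toℕ (lookup-map j (λ y → Fin.inject≤ y d≤k) v) ⟩
  toℕ (Fin.inject≤ (lookup v j) d≤k)                         ≡⟨ Fin.toℕ-inject≤ (lookup v j) d≤k ⟩
  toℕ (lookup v j)                                           <⟨ Fin.toℕ<n (lookup v j) ⟩
  d                                                          ∎
  where
  open ≤-Reasoning
  j = Fin.reduce≥ x k≤x

-- Two prefix positions descend. If the later position is in `v`, its letter is below `d`, and the
-- earlier letter is either below `d` too or larger.
canonical-descending : ∀ {k d r} (d≤k : d ≤ℕ k) (v : Vec (Fin d) r) → Descending d (canonical d≤k v)
canonical-descending {k} {d} d≤k v {x} {y} x<y with toℕ y <? k
... | yes y<k = inj₁ (subst₂ _<_ (sym (lookup-canonical-< d≤k v y y<k))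
                                 (sym (lookup-canonical-< d≤k v x (<-trans x<y y<k)))
                                 (∸-monoʳ-< (s<s x<y) y<k))
... | no y≮k with lookup-canonical-≥ d≤k v y (≮⇒≥ y≮k) | toℕ (lookup (canonical d≤k v) x) <? d
...   | wy<d | yes wx<d = inj₂ (wx<d , wy<d)
...   | wy<d | no wx≮d  = inj₁ (<-≤-trans wy<d (≮⇒≥ wx≮d))

canonical-onto : ∀ {k d r} (d≤k : d ≤ℕ k) (v : Vec (Fin d) r) i → ∃ λ x → lookup (canonical d≤k v) x ≡ i
canonical-onto d≤k v i = opposite i Fin.↑ˡ _ ,
  trans (lookup-++ˡ (tabulate opposite) _ (opposite i)) (trans (lookup∘tabulate opposite (opposite i)) (Fin.opposite-involutive i))

-- Ordered by position in the word, the letters of the occurrence of ρ in the blocks i start with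
-- lookup i (ρ ⟨$⟩ˡ 0) and lookup i (ρ ⟨$⟩ˡ 1).
Ascends : ∀ {k m} → Permutation′ (2 + m) → (Fin k → Fin k) → Set
Ascends {k} {m} ρ σ = ∀ (i : Vec (Fin k) (2 + m)) → StrictlyIncreasing i →
  ∀ {x y} → σ x ≡ lookup i (ρ ⟨$⟩ˡ zero) → σ y ≡ lookup i (ρ ⟨$⟩ˡ suc zero) → x Fin.< y

-- As `i` increases, whether the first two letters ascend depends on `ρ` alone, so one choice of
-- identity or complement serves every `i`.
ascending-relabelling : ∀ {k m} (ρ : Permutation′ (2 + m)) → ∃ λ (σ : Fin k → Fin k) → (∀ x → σ (σ x) ≡ x) × Ascends ρ σ
ascending-relabelling ρ with Fin.<-cmp (ρ ⟨$⟩ˡ zero) (ρ ⟨$⟩ˡ suc zero)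
... | tri< lt _ _ = id , (λ _ → refl) , λ i inc e₀ e₁ → subst₂ Fin._<_ (sym e₀) (sym e₁) (inc _ _ lt)
... | tri≈ _ eq _ with () ← ⟨$⟩ˡ-injective ρ eq
... | tri> _ _ gt = opposite , Fin.opposite-involutive ,
  λ i inc e₀ e₁ → opposite-cancel-< (subst₂ Fin._<_ (sym e₁) (sym e₀) (inc _ _ gt))

-- The first two letters of an occurrence ascend, so the first one is below d, and then all 2 + m of them are.
descending-avoids : ∀ {k m n d} (ρ : Permutation′ (2 + m)) (σ : Fin k → Fin k) → Ascends ρ σ → d ≤ℕ suc m →
                    (w : Vec (Fin k) n) → Descending d w → Avoids (blocks (Vec.map σ w)) ρ
descending-avoids {m = m} {n} {d} ρ σ ascends d≤1+m w descending (i , inc , b , b∈ , iso) =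
  -- There are `2 + m` letters below `d ≤ suc m`, so two coincide, although an occurrence takes its
  -- elements from distinct blocks.
  let s , t , s<t , eq = Fin.pigeonhole (s≤s d≤1+m) (λ t → Fin.fromℕ< (letter<d t))
      letters≡ = Fin.toℕ-injective (trans (sym (Fin.toℕ-fromℕ< (letter<d s))) (trans (cong toℕ eq) (Fin.toℕ-fromℕ< (letter<d t))))
  in Fin.<-irrefl (⟨$⟩ˡ-injective ρ (strictlyIncreasing-injective i inc
       (trans (sym (σ-letter s)) (trans (cong σ letters≡) (σ-letter t))))) s<t
  where
  position : Fin (2 + m) → Fin n
  position t = lookup b (ρ ⟨$⟩ˡ t)
  position-mono : ∀ {s t} → s Fin.< t → position s Fin.< position t
  position-mono s<t = proj₂ (iso _ _) (subst₂ Fin._<_ (sym (inverseʳ ρ)) (sym (inverseʳ ρ)) s<t)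
  letter : Fin (2 + m) → Fin _
  letter t = lookup w (position t)
  σ-letter : ∀ t → σ (letter t) ≡ lookup i (ρ ⟨$⟩ˡ t)
  σ-letter t = trans (sym (lookup-map (position t) σ w)) (∈-blocks⁻ (Vec.map σ w) (b∈ (ρ ⟨$⟩ˡ t)))
  letter<d : ∀ t → toℕ (letter t) < d
  letter<d zero with descending (position-mono {zero} {suc zero} z<s)
  ... | inj₁ descent    = ⊥-elim (Fin.<-asym descent (ascends i inc (σ-letter zero) (σ-letter (suc zero))))
  ... | inj₂ (l₀<d , _) = l₀<d
  letter<d (suc t) with descending (position-mono {zero} {suc t} z<s)
  ... | inj₁ l<l₀      = <-trans l<l₀ (letter<d zero)
  ... | inj₂ (_ , l<d) = l<d

-- The lower bound

-- `partition` injects the words of length `r` over `d` letters into the avoiding partitions.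
op-lower-+ : ∀ k m (ρ : Permutation′ (2 + m)) r → (k ⊓ suc m) ^ r ≤ℕ op (k + r) k ρ
op-lower-+ k m ρ r = begin
  d ^ r                                            ≡⟨ cong (_^ r) (length-tabulate id) ⟨
  length (allFin d) ^ r                            ≡⟨ length-allVec (allFin d) r ⟨
  length (allVec (allFin d) r)                     ≡⟨ length-map partition (allVec (allFin d) r) ⟨
  length (List.map partition (allVec (allFin d) r)) ≤⟨ Unique-⊆⇒length≤
    (Unique.map⁺ partition-injective (allVec-unique (Unique.allFin⁺ d) r)) good ⟩
  op (k + r) k ρ                                   ∎
  where
  open ≤-Reasoning
  d = k ⊓ suc m
  d≤k : d ≤ℕ k
  d≤k = m⊓n≤m k (suc m)
  relabelling = ascending-relabelling ρ
  σ : Fin k → Fin k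
  σ = proj₁ relabelling
  σ-involutive = proj₁ (proj₂ relabelling)
  σ-injective : ∀ {x y} → σ x ≡ σ y → x ≡ y
  σ-injective {x} {y} eq = trans (sym (σ-involutive x)) (trans (cong σ eq) (σ-involutive y))
  word : Vec (Fin d) r → Vec (Fin k) (k + r)
  word v = Vec.map σ (canonical d≤k v)
  partition : Vec (Fin d) r → Vec (Subset (k + r)) k
  partition v = blocks (word v)
  partition-injective : ∀ {v w} → partition v ≡ partition w → v ≡ w
  partition-injective eq = Vec-map-injective (Fin.inject≤-injective d≤k d≤k _ _)
    (++-injectiveʳ (tabulate opposite) (tabulate opposite) (Vec-map-injective σ-injective (blocks-injective eq)))
  onto : ∀ v i → ∃ λ x → lookup (word v) x ≡ i
  onto v i = let x , eq = canonical-onto d≤k v (σ i) in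
    x , trans (lookup-map x σ (canonical d≤k v)) (trans (cong σ eq) (σ-involutive i))
  good? = λ (B : Vec (Subset (k + r)) k) → isOrderedPartition? B ×-dec avoids? B ρ
  good : ∀ {B} → B Membership.∈ List.map partition (allVec (allFin d) r) →
         B Membership.∈ filter good? (allVec (allSubsets (k + r)) k)
  good B∈ with Membership.∈-map⁻ partition B∈
  ... | v , _ , refl = Membership.∈-filter⁺ good? (allVec-complete allSubsets-complete (partition v))
    ( blocks-isOrderedPartition (word v) (onto v)
    , descending-avoids ρ σ (proj₂ (proj₂ relabelling)) (m⊓n≤n k (suc m)) (canonical d≤k v) (canonical-descending d≤k v) )

-- The prefix costs the factor `d ^ k`, which does not depend on `n` and so vanishes under the root.
op-lower : ∀ k m (ρ : Permutation′ (2 + m)) n → k ≤ℕ n → (k ⊓ suc m) ^ n ≤ℕ op n k ρ * (k ⊓ suc m) ^ k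
op-lower k m ρ n k≤n = begin
  d ^ n                         ≡⟨ cong (d ^_) (m+[n∸m]≡n k≤n) ⟨
  d ^ (k + (n ∸ k))             ≡⟨ ^-distribˡ-+-* d k (n ∸ k) ⟩
  d ^ k * d ^ (n ∸ k)           ≤⟨ *-monoʳ-≤ (d ^ k) (op-lower-+ k m ρ (n ∸ k)) ⟩
  d ^ k * op (k + (n ∸ k)) k ρ  ≡⟨ cong (λ z → d ^ k * op z k ρ) (m+[n∸m]≡n k≤n) ⟩
  d ^ k * op n k ρ              ≡⟨ *-comm (d ^ k) (op n k ρ) ⟩
  op n k ρ * d ^ k              ∎
  where
  open ≤-Reasoning
  d = k ⊓ suc m

-- Limits of roots

/-toℚᵘ : ∀ a i → ℚ.toℚᵘ (+ a ℚ./ suc i) ℚᵘ.≃ ℚᵘ.mkℚᵘ (+ a) i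
/-toℚᵘ a i = ℚ.toℚᵘ-fromℚᵘ (ℚᵘ.mkℚᵘ (+ a) i)

/-mono-≤ : ∀ a b i j → a * suc j ≤ℕ b * suc i → + a ℚ./ suc i ℚ.≤ + b ℚ./ suc j
/-mono-≤ a b i j h = ℚ.toℚᵘ-cancel-≤ (begin
  ℚ.toℚᵘ (+ a ℚ./ suc i) ≃⟨ /-toℚᵘ a i ⟩
  ℚᵘ.mkℚᵘ (+ a) i        ≤⟨ ℚᵘ.*≤* (subst₂ ℤ._≤_ (ℤ.pos-* a (suc j)) (ℤ.pos-* b (suc i)) (ℤ.+≤+ h)) ⟩
  ℚᵘ.mkℚᵘ (+ b) j        ≃⟨ /-toℚᵘ b j ⟨
  ℚ.toℚᵘ (+ b ℚ./ suc j) ∎)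
  where open ℚᵘ.≤-Reasoning

/-+ : ∀ a b i j → + a ℚ./ suc i ℚ.+ + b ℚ./ suc j ≡ + (a * suc j + b * suc i) ℚ./ (suc i * suc j)
/-+ a b i j = ℚ.toℚᵘ-injective (begin
  ℚ.toℚᵘ (+ a ℚ./ suc i ℚ.+ + b ℚ./ suc j)                    ≈⟨ ℚ.toℚᵘ-homo-+ (+ a ℚ./ suc i) (+ b ℚ./ suc j) ⟩
  ℚ.toℚᵘ (+ a ℚ./ suc i) ℚᵘ.+ ℚ.toℚᵘ (+ b ℚ./ suc j)          ≈⟨ ℚᵘ.+-cong (/-toℚᵘ a i) (/-toℚᵘ b j) ⟩
  ℚᵘ.mkℚᵘ (+ a) i ℚᵘ.+ ℚᵘ.mkℚᵘ (+ b) j                        ≡⟨ cong (λ z → ℚᵘ.mkℚᵘ z (j + i * suc j))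
                                                                   (cong₂ ℤ._+_ (ℤ.pos-* a (suc j)) (ℤ.pos-* b (suc i))) ⟨
  ℚᵘ.mkℚᵘ (+ (a * suc j + b * suc i)) (j + i * suc j)         ≈⟨ /-toℚᵘ (a * suc j + b * suc i) (j + i * suc j) ⟨
  ℚ.toℚᵘ (+ (a * suc j + b * suc i) ℚ./ (suc i * suc j))      ∎)
  where open import Relation.Binary.Reasoning.Setoid ℚᵘ.≃-setoid

0≤1/1+ : ∀ n → 0ℚ ℚ.≤ 1/1+ n
0≤1/1+ n = ℚ.nonNegative⁻¹ (1/1+ n) {{ℚ.normalize-nonNeg 1 (suc n)}}

-- A positive numerator is at least `1`, so the denominator of `ε` itself gives the witness.
1/1+-archimedean : ∀ ε → 0ℚ ℚ.< ε → ∃ λ q → 1/1+ q ℚ.≤ ε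
1/1+-archimedean (mkℚ (+ zero) q _)    (ℚ.*<* (ℤ.+<+ ()))
1/1+-archimedean (mkℚ (+ suc p) q _)   _ = q , ℚ.toℚᵘ-cancel-≤ (begin
  ℚ.toℚᵘ (1/1+ q)        ≃⟨ /-toℚᵘ 1 q ⟩
  ℚᵘ.mkℚᵘ (+ 1) q        ≤⟨ ℚᵘ.*≤* (ℤ.*-monoʳ-≤-nonNeg (+ suc q) {+ 1} {+ suc p} (ℤ.+≤+ (s≤s z≤n))) ⟩
  ℚᵘ.mkℚᵘ (+ suc p) q    ∎)
  where open ℚᵘ.≤-Reasoning
1/1+-archimedean (mkℚ -[1+ p ] q _)    (ℚ.*<* ())

∣p-q∣≤r : ∀ {p q r} → p ℚ.≤ q ℚ.+ r → q ℚ.≤ p ℚ.+ r → ℚ.∣ p ℚ.- q ∣ ℚ.≤ r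
∣p-q∣≤r {p} {q} {r} p≤ q≤ with ℚ.∣p∣≡p∨∣p∣≡-p (p ℚ.- q)
... | inj₁ e = subst₂ ℚ._≤_ (sym e) (solve 2 (λ q r → (q :+ r) :- q := r) refl q r) (ℚ.+-monoˡ-≤ (ℚ.- q) p≤)
  where open ℚ.+-*-Solver
... | inj₂ e = subst₂ ℚ._≤_ (trans (solve 2 (λ p q → q :- p := :- (p :- q)) refl p q) (sym e))
                 (solve 2 (λ p r → (p :+ r) :- p := r) refl p r) (ℚ.+-monoˡ-≤ (ℚ.- p) q≤)
  where open ℚ.+-*-Solver

^-cancelˡ-< : ∀ n {x y} → x ^ n < y ^ n → x < y
^-cancelˡ-< n lt = ≰⇒> λ y≤x → <⇒≱ lt (^-monoˡ-≤ n y≤x)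

-- With denominators cleared, the hypotheses give `a < (d + 1 / q) ^ n`, hence the approximation
-- `r / J` of the root is at most `d + 1 / q`.
floorRoot-≤ : ∀ n .{{_ : NonZero n}} a d {p} q J .{{_ : NonZero J}} →
              a ≤ℕ d ^ n * p → (d * q) ^ n * p < suc (d * q) ^ n →
              floorRoot n (a * J ^ n) * q ≤ℕ suc (d * q) * J
floorRoot-≤ n a d {p} q J a≤ lt = <⇒≤ (^-cancelˡ-< n (begin-strict
  (r * q) ^ n                   ≡⟨ ^-distribʳ-* r q n ⟩
  r ^ n * q ^ n                 ≤⟨ *-monoˡ-≤ (q ^ n) (floorRoot-lower n (a * J ^ n)) ⟩
  a * J ^ n * q ^ n             ≤⟨ *-monoˡ-≤ (q ^ n) (*-monoˡ-≤ (J ^ n) a≤) ⟩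
  d ^ n * p * J ^ n * q ^ n     ≡⟨ solve 4 (λ d p j q → d :* p :* j :* q := (d :* q) :* p :* j) refl (d ^ n) p (J ^ n) (q ^ n) ⟩
  d ^ n * q ^ n * p * J ^ n     ≡⟨ cong (λ z → z * p * J ^ n) (^-distribʳ-* d q n) ⟨
  (d * q) ^ n * p * J ^ n       <⟨ *-monoˡ-< (J ^ n) {{m^n≢0 J n}} lt ⟩
  suc (d * q) ^ n * J ^ n       ≡⟨ ^-distribʳ-* (suc (d * q)) J n ⟨
  (suc (d * q) * J) ^ n         ∎))
  where
  open ≤-Reasoning
  open +-*-Solver
  r = floorRoot n (a * J ^ n)

-- Here `x / q = d - 1 / q`. Were `suc r / J` below it, then
-- `d ^ n ≤ a * c ≤ (x / q) ^ n * c < d ^ n`.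
floorRoot-≥ : ∀ n .{{_ : NonZero n}} a d {c} {x} q J .{{_ : NonZero J}} → d * q ≡ suc x →
              d ^ n ≤ℕ a * c → x ^ n * c < suc x ^ n →
              d * q * J ≤ℕ suc (floorRoot n (a * J ^ n)) * q + J
floorRoot-≥ n a d {c} {x} q J dq≡ ≤ac lt = ≮⇒≥ λ small → <-irrefl refl (begin-strict
  (d * q) ^ n * J ^ n           ≡⟨ cong (_* J ^ n) (^-distribʳ-* d q n) ⟩
  d ^ n * q ^ n * J ^ n         ≤⟨ *-monoˡ-≤ (J ^ n) (*-monoˡ-≤ (q ^ n) ≤ac) ⟩
  a * c * q ^ n * J ^ n         ≡⟨ solve 4 (λ a c q j → a :* c :* q :* j := c :* (a :* j :* q)) refl a c (q ^ n) (J ^ n) ⟩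
  c * (a * J ^ n * q ^ n)       ≤⟨ *-monoʳ-≤ c (*-monoˡ-≤ (q ^ n) (<⇒≤ (floorRoot-upper n (a * J ^ n)))) ⟩
  c * (suc r ^ n * q ^ n)       ≡⟨ cong (c *_) (^-distribʳ-* (suc r) q n) ⟨
  c * (suc r * q) ^ n           ≤⟨ *-monoʳ-≤ c (^-monoˡ-≤ n (below small)) ⟩
  c * (x * J) ^ n               ≡⟨ cong (c *_) (^-distribʳ-* x J n) ⟩
  c * (x ^ n * J ^ n)           ≡⟨ solve 3 (λ c x j → c :* (x :* j) := x :* c :* j) refl c (x ^ n) (J ^ n) ⟩
  x ^ n * c * J ^ n             <⟨ *-monoˡ-< (J ^ n) {{m^n≢0 J n}} lt ⟩
  suc x ^ n * J ^ n             ≡⟨ cong (λ z → z ^ n * J ^ n) dq≡ ⟨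
  (d * q) ^ n * J ^ n           ∎)
  where
  open ≤-Reasoning
  open +-*-Solver
  r = floorRoot n (a * J ^ n)
  below : suc r * q + J < d * q * J → suc r * q ≤ℕ x * J
  below small = +-cancelʳ-≤ J _ _ (≤-trans (<⇒≤ small)
    (≤-reflexive (trans (cong (_* J) dq≡) (+-comm J (x * J)))))

/-upper : ∀ s d i j → s * suc j ≤ℕ suc (d * suc j) * suc i → + s ℚ./ suc i ℚ.≤ + d ℚ./ 1 ℚ.+ 1/1+ j
/-upper s d i j h = subst (+ s ℚ./ suc i ℚ.≤_) (sym (/-+ d 1 0 j))
  (/-mono-≤ s (d * suc j + 1 * 1) i (j + 0) (subst₂ _≤ℕ_
    (solve 2 (λ s j → s :* (con 1 :+ j) := s :* (con 1 :+ (j :+ con 0))) refl s j)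
    (solve 2 (λ e i → (con 1 :+ e) :* i := (e :+ con 1) :* i) refl (d * suc j) (suc i)) h))
  where open +-*-Solver

-- The `suc` on `s` accounts for the rounding of the floor and becomes the summand `1/1+ i`.
/-lower : ∀ s d i j → d * suc j * suc i ≤ℕ suc s * suc j + suc i →
          + d ℚ./ 1 ℚ.≤ + s ℚ./ suc i ℚ.+ (1/1+ i ℚ.+ 1/1+ j)
/-lower s d i j h = subst (+ d ℚ./ 1 ℚ.≤_)
  (sym (trans (cong (+ s ℚ./ suc i ℚ.+_) (/-+ 1 1 i j)) (/-+ s (1 * suc j + 1 * suc i) i (j + i * suc j))))
  (/-mono-≤ d (s * (suc i * suc j) + (1 * suc j + 1 * suc i) * suc i) 0 _ (subst₂ _≤ℕ_
    (solve 3 (λ d i j → d :* j :* i :* i := d :* (i :* (i :* j))) refl d (suc i) (suc j))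
    (solve 3 (λ s i j → ((con 1 :+ s) :* j :+ i) :* i
                        := (s :* (i :* j) :+ (con 1 :* j :+ con 1 :* i) :* i) :* con 1) refl s (suc i) (suc j))
    (*-monoˡ-≤ (suc i) h)))
  where open +-*-Solver

-- A squeeze to within `1/1+ q ≤ ε`: growth from `d * suc q` to its successor absorbs the
-- polynomial, and growth from its predecessor `x` absorbs `C`.
root-converges : ∀ (a : ℕ → ℕ) d .{{_ : NonZero d}} c r C K →
                 (∀ n → a n ≤ℕ d ^ n * (1 + c * n) ^ r) → (∀ n → K ≤ℕ n → d ^ n ≤ℕ a n * C) →
                 ConvergesTo (λ n → root n (a n)) (fromℚ (+ d ℚ./ 1))
root-converges a d c r C K upper lower ε 0<ε = suc (N₁ ⊔ N₂) ⊔ K , close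
  where
  q = proj₁ (1/1+-archimedean ε 0<ε)
  1/q≤ε = proj₂ (1/1+-archimedean ε 0<ε)
  x = d * suc q ∸ 1
  dq≡1+x : d * suc q ≡ suc x
  dq≡1+x = sym (suc-pred (d * suc q) {{m*n≢0 d (suc q)}})
  beyond₁ = polynomial*exponential<exponential r (d * suc q) c
  N₁ = proj₁ beyond₁
  -- The constant `C` is at most the linear factor `1 + C * n` once `n ≥ 1`.
  beyond₂ = polynomial*exponential<exponential 1 x C
  N₂ = proj₁ beyond₂

  constant<exponential : ∀ n .{{_ : NonZero n}} → N₂ < n → x ^ n * C < suc x ^ n
  constant<exponential n N₂<n = ≤-<-trans
    (*-monoʳ-≤ (x ^ n) (≤-trans (m≤m*n C n) (≤-trans (n≤1+n _) (≤-reflexive (sym (*-identityʳ _))))))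
    (proj₂ beyond₂ n N₂<n)

  -- The unfolded inequality of reals: subtraction evaluates at index `halve j`, and the two
  -- `1/1+ j` are the slack in `_≤_`.
  close : ∀ n .{{_ : NonZero n}} → suc (N₁ ⊔ N₂) ⊔ K ≤ℕ n → ∀ j →
          ℚ.∣ rootApprox n (a n) (halve j) ℚ.- + d ℚ./ 1 ∣ ℚ.≤ ε ℚ.+ (1/1+ j ℚ.+ 1/1+ j)
  close n N≤n j = ∣p-q∣≤r
    (ℚ.≤-trans (/-upper s d J q (floorRoot-≤ n (a n) d (suc q) (suc J) (upper n) (proj₂ beyond₁ n (≤-<-trans (m≤m⊔n N₁ N₂) N<n))))
               (ℚ.+-monoʳ-≤ (+ d ℚ./ 1) upperSlack))
    (ℚ.≤-trans (/-lower s d J q (floorRoot-≥ n (a n) d (suc q) (suc J) dq≡1+x (lower n K≤n)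
                                  (constant<exponential n (≤-<-trans (m≤n⊔m N₁ N₂) N<n))))
               (ℚ.+-monoʳ-≤ (rootApprox n (a n) J) lowerSlack))
    where
    J = halve j
    s = floorRoot n (a n * suc J ^ n)
    e = 1/1+ j
    N<n = m⊔n≤o⇒m≤o (suc (N₁ ⊔ N₂)) K N≤n
    K≤n = m⊔n≤o⇒n≤o (suc (N₁ ⊔ N₂)) K N≤n
    1/J≤e : 1/1+ J ℚ.≤ e
    1/J≤e = /-mono-≤ 1 1 J j (*-monoʳ-≤ 1 (s≤s (≤-trans (m≤m+n j j) (n≤1+n _))))
    open ℚ.≤-Reasoning
    upperSlack : 1/1+ q ℚ.≤ ε ℚ.+ (e ℚ.+ e)
    upperSlack = begin
      1/1+ q              ≡⟨ ℚ.+-identityʳ (1/1+ q) ⟨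
      1/1+ q ℚ.+ 0ℚ       ≤⟨ ℚ.+-mono-≤ 1/q≤ε (ℚ.+-mono-≤ (0≤1/1+ j) (0≤1/1+ j)) ⟩
      ε ℚ.+ (e ℚ.+ e)     ∎
    -- The rounding error `1/1+ J` goes into the slack, so that only `1/1+ q` is charged to `ε`.
    lowerSlack : 1/1+ J ℚ.+ 1/1+ q ℚ.≤ ε ℚ.+ (e ℚ.+ e)
    lowerSlack = begin
      1/1+ J ℚ.+ 1/1+ q   ≡⟨ ℚ.+-comm (1/1+ J) (1/1+ q) ⟩
      1/1+ q ℚ.+ 1/1+ J   ≤⟨ ℚ.+-mono-≤ 1/q≤ε 1/J≤e ⟩
      ε ℚ.+ e             ≡⟨ cong (ε ℚ.+_) (ℚ.+-identityʳ e) ⟨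
      ε ℚ.+ (e ℚ.+ 0ℚ)    ≤⟨ ℚ.+-monoʳ-≤ ε (ℚ.+-monoʳ-≤ e (0≤1/1+ j)) ⟩
      ε ℚ.+ (e ℚ.+ e)     ∎

theorem11 : (k : ℕ) .{{_ : NonZero k}} (m : ℕ) → 2 ≤ℕ m → (ρ : Permutation′ m) → ∃ λ (L : ℝ) → ConvergesTo (λ n → root n (op n k ρ)) L × 1ℝ ≤ L
theorem11 k@(suc k₁) (suc (suc m)) (s≤s (s≤s z≤n)) ρ =
  fromℚ (+ d ℚ./ 1) ,
  root-converges (λ n → op n k ρ) d k (potential (forbidden k ρ)) (d ^ k) k (op-upper k (suc m) ρ) (op-lower k m ρ) ,
  1≤d
  where
  -- The pattern has length `2 + m`, so `suc m` is its length minus one; both arguments are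
  -- successors, whence `1 ≤ d`.
  d = k ⊓ suc m
  1≤d : 1ℝ ≤ fromℚ (+ d ℚ./ 1)
  1≤d j = ℚ.≤-trans (/-mono-≤ 1 d 0 0 (s≤s z≤n))
    (ℚ.≤-trans (ℚ.≤-reflexive (sym (ℚ.+-identityʳ _)))
               (ℚ.+-monoʳ-≤ (+ d ℚ./ 1) (ℚ.+-mono-≤ (0≤1/1+ j) (0≤1/1+ j))))
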